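{- Let $D$ be a $d$-regular digraph on $n$ vertices $v_1,\dots,v_n$, and let $\{H_1,H_2,\dots,H_d\}$ be a dicycle factorization of $D$. Let $M(H_i)$ denote the $n\times n$ adjacency matrix of $H_i$ with respect to the ordering $v_1,\dots,v_n$ (the same ordering for all $i$). Then there is a labeling of $V(\overrightarrow{L}D)$ (that is, a bijection from the vertices of the line digraph $\overrightarrow{L}D$ to $\{1,\dots,dn\}$) such that the adjacency matrix of $\overrightarrow{L}D$ with respect to this labeling is the matrix product $$M(\overrightarrow{L}D)=(J_d\otimes I_n)\cdot\bigoplus_{i=1}^{d}M(H_i).$$
   Context: A digraph $D=(V,A)$ consists of a non-empty finite set $V(D)$ of vertices and a finite set $A(D)$ of ordered pairs of vertices called arcs; there are no multiple arcs, and loops $(v,v)$ are allowed. Given a bijective labeling (ordering) $v_1,\dots,v_n$ of the vertices, the adjacency matrix $M(D)$ is the $n\times n$ $(0,1)$-matrix with $M_{i,j}(D)=1$ if $(v_i,v_j)\in A(D)$ and $M_{i,j}(D)=0$ otherwise. A digraph $D$ is $d$-regular if every vertex $v\in V(D)$ has in-degree $|\{u:(u,v)\in A(D)\}|=d$ and out-degree $|\{u:(v,u)\in A(D)\}|=d$. A subdigraph $H$ of $D$ is a digraph with $V(H)\subseteq V(D)$ and $A(H)\subseteq A(D)$; it is a factor (spanning subdigraph) of $D$ if $V(H)=V(D)$. A dicycle factor of $D$ is a factor $H$ of $D$ such that $M(H)$ is a permutation matrix. A decomposition of $D$ is a set of subdigraphs of $D$ whose arc-sets are exactly the classes of a partition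 of $A(D)$. A dicycle factorization of $D$ is a decomposition of $D$ all of whose members are dicycle factors of $D$. The line digraph $\overrightarrow{L}D$ of $D$ has vertex-set $A(D)$; for arcs $(v_h,v_i),(v_j,v_k)\in A(D)$, the pair $((v_h,v_i),(v_j,v_k))$ is an arc of $\overrightarrow{L}D$ if and only if $v_i=v_j$. $I_n$ is the $n\times n$ identity matrix and $J_d$ is the $d\times d$ all-ones matrix. $\otimes$ denotes the Kronecker product of matrices (so $J_d\otimes I_n$ is the $dn\times dn$ matrix consisting of $d\times d$ blocks each equal to $I_n$), and $\bigoplus$ denotes the direct sum of matrices (so $\bigoplus_{i=1}^d M(H_i)$ is the $dn\times dn$ block-diagonal matrix with diagonal blocks $M(H_1),\dots,M(H_d)$ in this order). -}

module Defs where

open import Algebra.Properties.Semiring.Sum using (sum)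
open import Data.Bool using (Bool; true; false; T; if_then_else_)
open import Data.Fin using (Fin; zero; suc; _≟_; quotient; remainder)
open import Data.Fin.Permutation using (Permutation′; _⟨$⟩ʳ_)
open import Data.Fin.Properties using (*↔×; +↔⊎; 0↔⊥; 1↔⊤; inj⇒≟)
open import Data.Nat using (ℕ; zero; suc; _+_; _*_)
open import Data.Nat.Properties using (+-*-semiring)
open import Data.Product using (Σ; Σ-syntax; ∃; _×_; _,_; proj₁; proj₂; uncurry)
open import Data.Product.Function.Dependent.Propositional using (Σ-↔)
open import Data.Product.Function.NonDependent.Propositional using (_×-↔_)
open import Data.Sum using (_⊎_; inj₁; inj₂)
open import Data.Sum.Function.Propositional using (_⊎-↔_)
open import Function using (_∘_; _↔_; Inverse; mk↔ₛ′)
open import Function.Properties.Inverse using (↔-refl; ↔-sym; ↔-trans; ↔⇒↣)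
open import Relation.Binary using (DecidableEquality)
open import Relation.Binary.PropositionalEquality using (_≡_; refl)
open import Relation.Nullary using (⌊_⌋)

private
  variable
    m n p q d : ℕ

HasCardinality : Set → ℕ → Set
HasCardinality X k = X ↔ Fin k

Finite : Set → Set
Finite X = ∃ λ k → HasCardinality X k

subset-finite : ∀ {n} (P : Fin n → Bool) → Finite (Σ[ i ∈ Fin n ] T (P i))
subset-finite {zero}  P = 0 , mk↔ₛ′ (λ ()) (λ ()) (λ ()) (λ ())
subset-finite {suc n} P with subset-finite (P ∘ suc)
... | k , tail↔ = size (P zero) + k ,
  ↔-trans split (↔-trans (T↔ (P zero) ⊎-↔ tail↔) (↔-sym +↔⊎))
  where
  size : Bool → ℕ
  size b = if b then 1 else 0

  T↔ : ∀ b → T b ↔ Fin (size b)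
  T↔ true  = ↔-sym 1↔⊤
  T↔ false = ↔-sym 0↔⊥

  split : (Σ[ i ∈ Fin (suc n) ] T (P i)) ↔ (T (P zero) ⊎ (Σ[ i ∈ Fin n ] T (P (suc i))))
  split = mk↔ₛ′
    (λ { (zero , t) → inj₁ t ; (suc i , t) → inj₂ (i , t) })
    (λ { (inj₁ t) → zero , t ; (inj₂ (i , t)) → suc i , t })
    (λ { (inj₁ t) → refl ; (inj₂ _) → refl })
    (λ { (zero , t) → refl ; (suc i , t) → refl })

-- The vertex set may be empty here, because the line digraph of a digraph
-- without arcs has no vertices; where a digraph must have a vertex, this is
-- a separate hypothesis.
record Digraph : Set₁ where
  field
    V        : Set
    V-finite : Finite V
    arc      : V → V → Bool

  Arc : Set
  Arc = Σ[ e ∈ V × V ] T (uncurry arc e)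

  source target : Arc → V
  source ((u , _) , _) = u
  target ((_ , w) , _) = w

  _≟ⱽ_ : DecidableEquality V
  _≟ⱽ_ = inj⇒≟ (↔⇒↣ (proj₂ V-finite))

  Arc-finite : Finite Arc
  Arc-finite with V-finite
  ... | k , V↔ with ↔-trans (V↔ ×-↔ V↔) (↔-sym *↔×)
  ... | V×V↔ with subset-finite (uncurry arc ∘ Inverse.from V×V↔)
  ... | l , e = l , ↔-trans (↔-sym (Σ-↔ (↔-sym V×V↔) ↔-refl)) e

open Digraph

Regular : ℕ → Digraph → Set
Regular d D = ∀ v →
    HasCardinality (Σ[ u ∈ V D ] T (arc D u v)) d
  × HasCardinality (Σ[ u ∈ V D ] T (arc D v u)) d

lineDigraph : Digraph → Digraph
lineDigraph D = record
  { V        = Arc D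
  ; V-finite = Arc-finite D
  ; arc      = λ e f → ⌊ _≟ⱽ_ D (target D e) (source D f) ⌋
  }

Matrix : ℕ → ℕ → Set
Matrix m n = Fin m → Fin n → ℕ

infix 4 _≐_
_≐_ : Matrix m n → Matrix m n → Set
A ≐ B = ∀ i j → A i j ≡ B i j

I : ∀ n → Matrix n n
I n i j = if ⌊ i ≟ j ⌋ then 1 else 0

J : ∀ d → Matrix d d
J d _ _ = 1

infixl 7 _·_
_·_ : Matrix m n → Matrix n p → Matrix m p
(A · B) i j = sum +-*-semiring (λ k → A i k * B k j)

-- An index of Fin (m * p) splits as its block number (quotient) and its
-- position within that block (remainder).
infixl 8 _⊗_
_⊗_ : Matrix m n → Matrix p q → Matrix (m * p) (n * q)
_⊗_ {m} {n} {p} {q} A B i j =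
  A (quotient {m} p i) (quotient {n} q j) * B (remainder {m} p i) (remainder {n} q j)

⨁ : (Fin d → Matrix n n) → Matrix (d * n) (d * n)
⨁ {d} {n} M i j =
  if ⌊ quotient {d} n i ≟ quotient {d} n j ⌋
  then M (quotient {d} n i) (remainder {d} n i) (remainder {d} n j)
  else 0

IsPermutationMatrix : Matrix n n → Set
IsPermutationMatrix {n} M = ∃ λ (π : Permutation′ n) → M ≐ λ i j → I n (π ⟨$⟩ʳ i) j

Labeling : Digraph → ℕ → Set
Labeling D n = V D ↔ Fin n

adjacencyMatrix : (D : Digraph) → Labeling D n → Matrix n n
adjacencyMatrix D ℓ i j = if arc D (Inverse.from ℓ i) (Inverse.from ℓ j) then 1 else 0

-- A spanning subdigraph shares its vertex set with D, so only its arc set is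
-- data, and every labeling of D is a labeling of the factor.
record Factor (D : Digraph) : Set where
  field
    arcᶠ   : V D → V D → Bool
    arcᶠ⊆A : ∀ u v → T (arcᶠ u v) → T (arc D u v)

  digraph : Digraph
  digraph = record { V = V D ; V-finite = V-finite D ; arc = arcᶠ }

open Factor public using (digraph)

-- Being a permutation matrix does not depend on the labeling, so requiring it
-- for one labeling is the same as requiring it for all.
IsDicycleFactor : ∀ {D} → Factor D → Set
IsDicycleFactor H = ∃ λ n → Σ[ ℓ ∈ Labeling (digraph H) n ]
  IsPermutationMatrix (adjacencyMatrix (digraph H) ℓ)

-- Disjointness is stated on indices; as the classes are non-empty, it also
-- makes the members of the family pairwise distinct.
record IsDecomposition {D : Digraph} (H : Fin d → Factor D) : Set where
  field
    nonEmpty : ∀ k → Arc (digraph (H k))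
    covering : ∀ u v → T (arc D u v) → ∃ λ k → T (arc (digraph (H k)) u v)
    disjoint : ∀ u v k l → T (arc (digraph (H k)) u v) → T (arc (digraph (H l)) u v) → k ≡ l

IsDicycleFactorization : ∀ {D} → (Fin d → Factor D) → Set
IsDicycleFactorization H = IsDecomposition H × (∀ k → IsDicycleFactor (H k))

{-# OPTIONS --safe #-}
module Submission where

-- In a dicycle factor every vertex has exactly one in-arc, so an arc of D is
-- determined by the factor Hₖ containing it together with its target vᵢ. Label
-- this arc by (k , i). The arc labelled (k , i) is followed by the one labelled
-- (l , j) exactly when the source of the latter is vᵢ, that is, when (vᵢ , vⱼ)
-- is an arc of Hₗ; and ((J ⊗ I) · ⨁ M(H)) at ((k , i) , (l , j)) is M(Hₗ) at
-- (i , j).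

open import Defs
open import Algebra.Properties.Semiring.Sum using (sum; sum-remove; sum-cong-≗; sum-replicate-zero)
open import Data.Bool using (true; false; T; if_then_else_)
open import Data.Bool.Properties using (T-irrelevant)
open import Data.Fin using (Fin; _≟_; punchIn; combine; remQuot; quotient; remainder)
open import Data.Fin.Permutation using (_⟨$⟩ʳ_; _⟨$⟩ˡ_; inverseˡ; inverseʳ)
open import Data.Fin.Properties using (*↔×; combine-remQuot; remQuot-combine; punchInᵢ≢i)
open import Data.Nat using (ℕ; suc; NonZero; _+_; _*_)
open import Data.Nat.Properties using (+-*-semiring; +-identityʳ)
open import Data.Product using (Σ-syntax; _×_; _,_; proj₁; proj₂)
open import Data.Product.Function.NonDependent.Propositional using (_×-↔_)
open import Data.Unit using (tt)
open import Function using (_∘_; _↔_; Inverse; mk↔ₛ′)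
open import Function.Properties.Inverse using (↔-refl; ↔-sym; ↔-trans)
open import Relation.Binary.PropositionalEquality
  using (_≡_; _≢_; refl; sym; trans; cong; cong₂; subst; module ≡-Reasoning)
open import Relation.Nullary using (yes; no; ⌊_⌋; contradiction)
open import Relation.Nullary.Decidable using (toWitness; fromWitness)

open Digraph
open Factor

private
  variable
    d n : ℕ

indicator-injective : ∀ {b c} → (if b then 1 else 0) ≡ (if c then 1 else 0) → b ≡ c
indicator-injective {true}  {true}  _ = refl
indicator-injective {false} {false} _ = refl

indicator-cong : ∀ {b c} → (T b → T c) → (T c → T b) →
  (if b then 1 else 0) ≡ (if c then 1 else 0)
indicator-cong {true}  {true}  _   _   = refl
indicator-cong {true}  {false} b⇒c _   = contradiction tt b⇒c
indicator-cong {false} {true}  _   c⇒b = contradiction tt c⇒b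
indicator-cong {false} {false} _   _   = refl

sum-single : ∀ (f : Fin n → ℕ) k → (∀ i → i ≢ k → f i ≡ 0) → sum +-*-semiring f ≡ f k
sum-single {suc n} f k f≡0 = begin
  sum +-*-semiring f
    ≡⟨ sum-remove +-*-semiring f ⟩
  f k + sum +-*-semiring (f ∘ punchIn k)
    ≡⟨ cong (f k +_) (sum-cong-≗ +-*-semiring (λ i → f≡0 _ (punchInᵢ≢i k i))) ⟩
  f k + sum +-*-semiring {n} (λ _ → 0)
    ≡⟨ cong (f k +_) (sum-replicate-zero +-*-semiring n) ⟩
  f k + 0
    ≡⟨ +-identityʳ (f k) ⟩
  f k ∎
  where open ≡-Reasoning

-- Only one summand of the product can be nonzero: the identity blocks force the position within the
-- block to be that of `i`, and the block-diagonal factor forces the block to be that of `j`.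
J⊗I·⨁ : ∀ (M : Fin d → Matrix n n) i j →
  ((J d ⊗ I n) · ⨁ M) i j ≡ M (quotient {d} n j) (remainder {d} n i) (remainder {d} n j)
J⊗I·⨁ {d} {n} M i j = trans (sum-single f m off-m) at-m
  where
  l = quotient {d} n j
  r = remainder {d} n i
  s = remainder {d} n j
  m = combine l r

  entry : Fin d × Fin n → ℕ
  -- The factor `1` is the entry of `J`; keeping it makes `f` definitionally the summand of the
  -- matrix product.
  entry (l′ , r′) = 1 * I n r r′ * (if ⌊ l′ ≟ l ⌋ then M l′ r′ s else 0)

  f : Fin (d * n) → ℕ
  f = entry ∘ remQuot {d} n

  entry-off : ∀ q → q ≢ (l , r) → entry q ≡ 0
  entry-off (l′ , r′) q≢ with r ≟ r′ | l′ ≟ l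
  ... | no _     | _        = refl
  ... | yes _    | no _     = refl
  ... | yes refl | yes refl = contradiction refl q≢

  off-m : ∀ k → k ≢ m → f k ≡ 0
  off-m k k≢m = entry-off (remQuot {d} n k) λ eq →
    k≢m (trans (sym (combine-remQuot {d} n k)) (cong (λ (a , b) → combine a b) eq))

  entry-at : entry (l , r) ≡ M l r s
  entry-at with r ≟ r | l ≟ l
  ... | yes _  | yes _  = +-identityʳ (M l r s)
  ... | no r≢r | _      = contradiction refl r≢r
  ... | yes _  | no l≢l = contradiction refl l≢l

  at-m : f m ≡ M l r s
  at-m = trans (cong entry (remQuot-combine l r)) entry-at

module _ {D : Digraph} (H : Factor D) (dicycle : IsDicycleFactor H) where
  private
    ℓ = proj₁ (proj₂ dicycle)
    π = proj₁ (proj₂ (proj₂ dicycle))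
    open Inverse ℓ using (to; from; strictlyInverseˡ; strictlyInverseʳ)

    -- The labeling `ℓ` that witnesses the dicycle factor may differ from one factor to another, so
    -- the permutation is transferred to the vertices themselves.
    arcᶠ≡ : ∀ u w → arcᶠ H u w ≡ ⌊ π ⟨$⟩ʳ to u ≟ to w ⌋
    arcᶠ≡ u w = trans
      (sym (cong₂ (arcᶠ H) (strictlyInverseʳ u) (strictlyInverseʳ w)))
      (indicator-injective (proj₂ (proj₂ (proj₂ dicycle)) (to u) (to w)))

  -- Row `i` of the permutation matrix has its 1 in column `π i`, so `π` takes the source of an arc
  -- to its target, and its inverse recovers the source.
  predecessor : V D → V D
  predecessor w = from (π ⟨$⟩ˡ to w)

  predecessor-arc : ∀ w → T (arcᶠ H (predecessor w) w)
  predecessor-arc w = subst T (sym (arcᶠ≡ _ w)) (fromWitness (begin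
    π ⟨$⟩ʳ to (from (π ⟨$⟩ˡ to w))  ≡⟨ cong (π ⟨$⟩ʳ_) (strictlyInverseˡ _) ⟩
    π ⟨$⟩ʳ (π ⟨$⟩ˡ to w)            ≡⟨ inverseʳ π ⟩
    to w                            ∎))
    where open ≡-Reasoning

  predecessor-unique : ∀ u w → T (arcᶠ H u w) → u ≡ predecessor w
  predecessor-unique u w uw = begin
    u
      ≡⟨ strictlyInverseʳ u ⟨
    from (to u)
      ≡⟨ cong from (inverseˡ π) ⟨
    from (π ⟨$⟩ˡ (π ⟨$⟩ʳ to u))
      ≡⟨ cong (from ∘ (π ⟨$⟩ˡ_)) (toWitness (subst T (arcᶠ≡ u w) uw)) ⟩
    from (π ⟨$⟩ˡ to w) ∎
    where open ≡-Reasoning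

module _ (D : Digraph) (H : Fin d → Factor D) (factorization : IsDicycleFactorization H) where
  open IsDecomposition (proj₁ factorization)

  pred : Fin d → V D → V D
  pred k = predecessor (H k) (proj₂ factorization k)

  pred-arc : ∀ k w → T (arcᶠ (H k) (pred k w) w)
  pred-arc k = predecessor-arc (H k) (proj₂ factorization k)

  pred-unique : ∀ k u w → T (arcᶠ (H k) u w) → u ≡ pred k w
  pred-unique k = predecessor-unique (H k) (proj₂ factorization k)

  Arc↔class×target : Arc D ↔ (Fin d × V D)
  Arc↔class×target = mk↔ₛ′ to from to-from from-to
    where
    to : Arc D → Fin d × V D
    to ((u , w) , a) = proj₁ (covering u w a) , w

    from : Fin d × V D → Arc D
    from (k , w) = (pred k w , w) , arcᶠ⊆A (H k) _ _ (pred-arc k w)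

    to-from : ∀ kw → to (from kw) ≡ kw
    -- `covering` may return any class containing the arc; disjointness identifies it with `k`.
    to-from (k , w) = cong (_, w)
      (disjoint _ w _ k (proj₂ (covering _ w _)) (pred-arc k w))

    -- Membership in the arc set is a proposition, so the endpoints determine the arc.
    Arc-≡ : ∀ {u u′ w} {a : T (arc D u w)} {a′ : T (arc D u′ w)} → u ≡ u′ →
      _≡_ {A = Arc D} ((u , w) , a) ((u′ , w) , a′)
    Arc-≡ {u} {w = w} refl = cong ((u , w) ,_) (T-irrelevant _ _)

    from-to : ∀ e → from (to e) ≡ e
    from-to ((u , w) , a) = Arc-≡ (sym (pred-unique _ u w (proj₂ (covering u w a))))

mainTheorem1 : (d n : ℕ) → .{{_ : NonZero n}} →
    (D : Digraph) → Regular d D →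
    (v : Labeling D n) →
    (H : Fin d → Factor D) → IsDicycleFactorization H →
    Σ[ ℓ ∈ Labeling (lineDigraph D) (d * n) ]
    adjacencyMatrix (lineDigraph D) ℓ
    ≐ (J d ⊗ I n) · ⨁ (λ k → adjacencyMatrix (digraph (H k)) v)
mainTheorem1 d n D _ v H F = ℓ , λ i j → trans
  (line-entry (remQuot {d} n i) (remQuot {d} n j))
  (sym (J⊗I·⨁ (λ k → adjacencyMatrix (digraph (H k)) v) i j))
  where
  ℓ : Labeling (lineDigraph D) (d * n)
  -- The class becomes the block number and the target the position within the block, matching the
  -- index convention of `⊗` and `⨁`.
  ℓ = ↔-trans (Arc↔class×target D H F) (↔-trans (↔-refl ×-↔ v) (↔-sym *↔×))

  vertex : Fin n → V D
  vertex = Inverse.from v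

  -- Under `ℓ`, the arc at `(k , i)` has target `vertex i`, and the arc at `(l , j)` has source
  -- `pred D H F l (vertex j)`. These coincide exactly when the factor `H l` has an arc from
  -- `vertex i` to `vertex j`, since the in-neighbour in `H l` exists and is unique.
  line-entry : ∀ ((k , i) (l , j) : Fin d × Fin n) →
    (if ⌊ _≟ⱽ_ D (vertex i) (pred D H F l (vertex j)) ⌋ then 1 else 0)
      ≡ (if arcᶠ (H l) (vertex i) (vertex j) then 1 else 0)
  line-entry (_ , i) (l , j) = indicator-cong
    (λ t → subst (λ u → T (arcᶠ (H l) u (vertex j))) (sym (toWitness t)) (pred-arc D H F l (vertex j)))
    (λ a → fromWitness (pred-unique D H F l (vertex i) (vertex j) a))
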